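{- For every integer $r \geq 2$ and every $\varepsilon > 0$ there is $\beta = \beta(r,\varepsilon) > 0$ such that every connected $n$-vertex $\beta$-graph $G$ satisfies the following: in any $r$-colouring of $E(G)$ there is a spanning tree of $G$ with at least $(\varphi(r) - \varepsilon) \cdot n$ edges of the same colour.
   Context: For $\beta>0$, a graph $G=(V,E)$ is a $\beta$-graph if $|V|\ge 1/\beta$ and there is an edge of $G$ between every pair of disjoint sets $U,W\subseteq V$ with $|U|,|W|\ge\beta|V|$. For integers $r,n$, $\varphi(r,n)$ is the smallest integer $k$ for which there are $k$-element sets $A_1,\dots,A_r\in\binom{[n]}{k}$ such that every pair $e\in\binom{[n]}{2}$ is contained in $A_i$ for some $i\in[r]$. Define $\varphi(r):=\lim_{n\to\infty}\varphi(r,n)/n$. It is known (Mills; Horák and Sauer) that this limit exists and equals $\min_n \varphi(r,n)/n$; in particular $\varphi(r,n)\ge\varphi(r)\cdot n$ for every $n$. -}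

module Defs where

open import Data.Bool.Base using (Bool; T)
open import Data.Bool.Properties using (T?; T-irrelevant)
open import Data.Fin.Base using (Fin)
import Data.Fin.Base as Fin
import Data.Fin.Properties as Fin
open import Data.Fin.Subset using (Subset; _∈_; ∣_∣; _∩_; Empty; ⊤)
open import Data.Fin.Subset.Properties using (_∈?_; anySubset?; ∈⊤; ∣⊤∣≡n)
open import Data.Integer.Base using (+_)
open import Data.List.Base using (List; _∷_; [_]; _++_; length; filter; allFin; cartesianProduct)
open import Data.List.Relation.Unary.Linked using (Linked)
open import Data.List.Relation.Unary.Unique.Propositional using (Unique)
open import Data.Nat.Base as ℕ using (ℕ; zero; suc; z≤n; s≤s; NonZero)
import Data.Nat.Properties as ℕ
open import Data.Product.Base using (Σ-syntax; ∃; ∃-syntax; _×_; _,_; proj₁; uncurry)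
open import Data.Rational.Base using (ℚ; _/_; _<_; _≤_; _*_; _-_; 0ℚ; 1/_; Positive)
import Data.Rational.Base as ℚ
open import Data.Rational.Properties using (pos⇒nonZero)
open import Data.Vec.Base using (Vec; []; _∷_; replicate)
open import Data.Vec.Relation.Unary.All as All using (All; []; _∷_)
open import Data.Vec.Relation.Unary.Any as Any using (Any; here)
open import Level using (0ℓ)
open import Relation.Binary.Construct.Closure.ReflexiveTransitive using (Star)
open import Relation.Binary.PropositionalEquality using (_≡_; _≢_; trans; cong)
open import Relation.Nullary using (¬_; Dec; yes; no; contradiction)
open import Relation.Nullary.Decidable using (map′; ¬?; _×-dec_; _→-dec_)
open import Relation.Unary using (Pred; Decidable)

ℕ→ℚ : ℕ → ℚ
ℕ→ℚ n = + n / 1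

------------------------------------------------------------------------
-- Finite simple graphs on the vertex set Fin n

record Graph (n : ℕ) : Set where
  field
    adj        : Fin n → Fin n → Bool
    adj-sym    : ∀ u v → T (adj u v) → T (adj v u)
    adj-irrefl : ∀ v → ¬ T (adj v v)

  Adj : Fin n → Fin n → Set
  Adj u v = T (adj u v)

open Graph public

-- Each edge occurs exactly once, with its smaller endpoint first.
edges : ∀ {n} → Graph n → List (Fin n × Fin n)
edges {n} G =
  filter (uncurry λ u v → (u Fin.<? v) ×-dec T? (adj G u v))
         (cartesianProduct (allFin n) (allFin n))

-- The graph on zero vertices counts as connected here.
Connected : ∀ {n} → Graph n → Set
Connected G = ∀ u v → Star (Adj G) u v

-- The cycle start, w₁, …, w_k, start with k ≥ 2 and all listed vertices distinct.
record Cycle {n} (G : Graph n) : Set where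
  field
    start    : Fin n
    others   : List (Fin n)
    long     : 2 ℕ.≤ length others
    distinct : Unique (start ∷ others)
    closed   : Linked (Adj G) (start ∷ others ++ [ start ])

IsTree : ∀ {n} → Graph n → Set
IsTree G = Connected G × ¬ Cycle G

IsSpanningTree : ∀ {n} → Graph n → Graph n → Set
IsSpanningTree H G = (∀ u v → Adj H u v → Adj G u v) × IsTree H

record IsβGraph (β : ℚ) .{{_ : Positive β}} {n : ℕ} (G : Graph n) : Set where
  field
    order : (1/ β) {{pos⇒nonZero β}} ≤ ℕ→ℚ n
    joins : ∀ (U W : Subset n) → Empty (U ∩ W) →
            β * ℕ→ℚ n ≤ ℕ→ℚ ∣ U ∣ → β * ℕ→ℚ n ≤ ℕ→ℚ ∣ W ∣ →
            ∃[ u ] ∃[ w ] u ∈ U × w ∈ W × Adj G u w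

-- Not required to be proper.  Adj G u v is a proposition, so the colour
-- depends only on the unordered pair {u, v}.
record Colouring {n} (G : Graph n) (r : ℕ) : Set where
  field
    colour     : ∀ u v → Adj G u v → Fin r
    colour-sym : ∀ u v (e : Adj G u v) (e′ : Adj G v u) → colour u v e ≡ colour v u e′

open Colouring public

module _ {n r} {G : Graph n} (c : Colouring G r) (i : Fin r) where

  HasColour : Fin n → Fin n → Set
  HasColour u v = Σ[ e ∈ Adj G u v ] colour c u v e ≡ i

  hasColour? : ∀ u v → Dec (HasColour u v)
  hasColour? u v with T? (adj G u v)
  ... | no ¬e = no λ (e , _) → ¬e e
  ... | yes e = map′ (e ,_)
    (λ (e′ , eq) → trans (cong (colour c u v) (T-irrelevant e e′)) eq)
    (colour c u v e Fin.≟ i)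

  edgesOfColour : Graph n → List (Fin n × Fin n)
  edgesOfColour H = filter (uncurry hasColour?) (edges H)

------------------------------------------------------------------------
-- Covering the pairs of an n-set by r sets of size k

Covers : ∀ {r n} → Vec (Subset n) r → Set
Covers A = ∀ x y → x ≢ y → Any (λ S → x ∈ S × y ∈ S) A

HasCover : (r n k : ℕ) → Set
HasCover r n k = Σ[ A ∈ Vec (Subset n) r ] All (λ S → ∣ S ∣ ≡ k) A × Covers A

IsLeast : Pred ℕ 0ℓ → ℕ → Set
IsLeast P k = P k × (∀ j → P j → k ℕ.≤ j)

anyVec? : ∀ {n r} {P : Pred (Vec (Subset n) r) 0ℓ} → Decidable P → Dec (∃ P)
anyVec? {r = zero}  P? = map′ ([] ,_) (λ { ([] , p) → p }) (P? [])
anyVec? {r = suc r} P? =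
  map′ (λ (S , A , p) → S ∷ A , p) (λ { (S ∷ A , p) → S , A , p })
       (anySubset? λ S → anyVec? λ A → P? (S ∷ A))

covers? : ∀ {r n} → Decidable (Covers {r} {n})
covers? A = Fin.all? λ x → Fin.all? λ y →
  ¬? (x Fin.≟ y) →-dec Any.any? (λ S → (x ∈? S) ×-dec (y ∈? S)) A

hasCover? : ∀ r n → Decidable (HasCover r n)
hasCover? r n k = anyVec? λ A → All.all? (λ S → ∣ S ∣ ℕ.≟ k) A ×-dec covers? A

trivialCover : ∀ r n .{{_ : NonZero r}} → HasCover r n n
trivialCover (suc r) n = replicate (suc r) ⊤ , sizes (suc r) , λ _ _ _ → here (∈⊤ , ∈⊤)
  where
  sizes : ∀ m → All (λ S → ∣ S ∣ ≡ n) (replicate m (⊤ {n}))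
  sizes zero    = []
  sizes (suc m) = ∣⊤∣≡n n ∷ sizes m

least : ∀ {P : Pred ℕ 0ℓ} → Decidable P → ∀ n → P n → ∃ (IsLeast P)
least P? zero    p = zero , p , λ _ _ → z≤n
least P? (suc n) p with P? zero
... | yes p₀ = zero , p₀ , λ _ _ → z≤n
... | no ¬p₀ with least (λ k → P? (suc k)) n p
...   | k , pₖ , minimal = suc k , pₖ , λ where
        zero    p₀ → contradiction p₀ ¬p₀
        (suc j) pⱼ → s≤s (minimal j pⱼ)

leastCover : ∀ r n .{{_ : NonZero r}} → ∃ (IsLeast (HasCover r n))
leastCover r n = least (hasCover? r n) n (trivialCover r n)

φ : (r n : ℕ) .{{_ : NonZero r}} → ℕ
φ r n = proj₁ (leastCover r n)

IsLimit : ((n : ℕ) .{{_ : NonZero n}} → ℚ) → ℚ → Set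
IsLimit a x =
  ∀ ε → 0ℚ < ε → ∃[ N ] ∀ n .{{_ : NonZero n}} → N ℕ.≤ n → ℚ.∣ a n - x ∣ < ε

-- x = lim φ(r,n)/n.  Nothing is lost by taking x rational: the limit exists and
-- equals the (attained) minimum of φ(r,n)/n over n ≥ 2.
IsLimitφ : (r : ℕ) .{{_ : NonZero r}} → ℚ → Set
IsLimitφ r = IsLimit λ n → + φ r n / n

{-# OPTIONS --safe #-}

-- For each colour i take a spanning tree of G containing a spanning forest of
-- the graph of colour i, so that it has n − (number of components in colour i)
-- edges of colour i.  Fix a constant M and give a vertex v the type
-- S(v) = {i : the component of v in colour i has at least M vertices}.  If two
-- classes of vertices have disjoint types S and T, then every edge between them
-- lies in a component with fewer than M vertices, so a vertex of one class has at
-- most rM neighbours in the other; in a β-graph with β small this forces one of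
-- the classes to be small.  Hence, apart from the few vertices of rare type, any
-- two types intersect, and the sets A_i = {v : v has rare type or i ∈ S(v)} cover
-- all pairs.  So |A_i| ≥ φ(r, n) for some i, and since there are at most n/M
-- components with at least M vertices, the tree of colour i has at least
-- |A_i| − n/M − (number of vertices of rare type) edges of colour i.

module Submission where

open import Defs
open import Algebra.Properties.CommutativeMonoid.Sum as Sum using ()
open import Data.Bool.Base using (true; false; T)
open import Data.Bool.Properties using (T?)
import Data.Fin as Fin
open import Data.Fin.Base using (Fin; zero; suc; funToFin; finToFun)
open import Data.Fin.Properties using (_≟_; any?; <-cmp; finToFun-funToFin)
open import Data.Fin.Subset
  using (Subset; Side; _∈_; _∉_; _⊆_; _⊂_; _∪_; _∩_; _─_; ∁; ⁅_⁆; ⊤; ⊥; ∣_∣; Empty)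
open import Data.Fin.Subset.Properties
open import Data.List.Base
  using (List; []; _∷_; _++_; [_]; length; filter; allFin; cartesianProduct; initLast; _∷ʳ′_)
import Data.List.Membership.DecPropositional as DecMembership
import Data.List.Membership.Propositional as List
open import Data.List.Membership.Propositional.Properties
  using (∈-∃++; ∈-filter⁺; ∈-filter⁻; ∈-cartesianProduct⁺; ∈-allFin)
open import Data.List.Properties using (++-assoc)
open import Data.List.Relation.Binary.Permutation.Propositional using (_↭_; ↭⇒↭ₛ)
open import Data.List.Relation.Binary.Permutation.Propositional.Properties using (++-comm; ↭-length)
open import Data.List.Relation.Binary.Permutation.Setoid.Properties using (Unique-resp-↭)
open import Data.List.Relation.Binary.Pointwise using (Pointwise-≡⇒≡)
open import Data.List.Relation.Binary.Sublist.Propositional as Sublist using () renaming (_⊆_ to _⊑_)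
import Data.List.Relation.Binary.Sublist.Propositional.Properties as Sublist
open import Data.List.Relation.Unary.All as List using ([]; _∷_)
import Data.List.Relation.Unary.All.Properties as List
open import Data.List.Relation.Unary.AllPairs using ([]; _∷_)
open import Data.List.Relation.Unary.Any using (here; there)
open import Data.List.Relation.Unary.Linked using (Linked; []; [-]; _∷_)
open import Data.Nat.Base as ℕ
  using (ℕ; zero; suc; NonZero; z≤n; s≤s; s≤s⁻¹; NonTrivial; nonTrivial⇒nonZero)
open import Data.Nat.DivMod using (m≡m%n+[m/n]*n; m%n<n; m/n*n≤m)
import Data.Nat.Properties as ℕ
open import Data.Nat.Solver using (module +-*-Solver)
open import Data.Product.Base using (Σ-syntax; ∃-syntax; _×_; _,_; proj₁; proj₂; uncurry)
open import Data.Sum.Base using (_⊎_; inj₁; inj₂)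
open import Data.Vec.Base as Vec using ([]; _∷_; here; there; tabulate)
open import Data.Vec.Properties using ([]=⇒lookup; lookup⇒[]=; lookup∘tabulate)
import Data.Vec.Relation.Unary.All.Properties as All
import Data.Vec.Relation.Unary.Any.Properties as Any
open import Function.Base using (_∘_; id; case_of_)
open import Level using (0ℓ)
open import Relation.Binary.Construct.Closure.ReflexiveTransitive as Star using (Star; _◅_; _◅◅_)
open import Relation.Binary.Core using (Rel)
open import Relation.Binary.Definitions using (tri<; tri≈; tri>) renaming (Decidable to Decidable₂)
open import Relation.Binary.PropositionalEquality
  using (_≡_; _≢_; refl; sym; trans; cong; cong₂; subst; subst₂; setoid)
open import Relation.Nullary using (¬_; Dec; yes; no; does; contradiction)
open import Relation.Nullary.Decidable
  using (⌊_⌋; toWitness; fromWitness; decidable-stable; dec-true; ¬?; _⊎-dec_; _×-dec_)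
open import Relation.Unary using (Pred; Decidable)

module _ where

  open import Data.Nat.Base using (_+_; _*_; _∸_; _^_; _≤_; _<_)
  open import Data.Nat.Properties hiding (_≟_; <-cmp)
  open Sum +-0-commutativeMonoid using (sum; sum-cong-≗; ∑-comm)
  open +-*-Solver using (solve; con; _:+_; _:*_; _:=_)

  -- Counting in finite sets

  ⟦_⟧ : ∀ {n} {P : Pred (Fin n) 0ℓ} → Decidable P → Subset n
  ⟦ P? ⟧ = tabulate (does ∘ P?)

  module _ {n} {P : Pred (Fin n) 0ℓ} (P? : Decidable P) where

    ∈⟦⟧⁺ : ∀ {x} → P x → x ∈ ⟦ P? ⟧
    ∈⟦⟧⁺ {x} p = lookup⇒[]= x _ (trans (lookup∘tabulate (does ∘ P?) x) (dec-true (P? x) p))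

    ∈⟦⟧⁻ : ∀ {x} → x ∈ ⟦ P? ⟧ → P x
    ∈⟦⟧⁻ {x} x∈ with P? x | trans (sym (lookup∘tabulate (does ∘ P?) x)) ([]=⇒lookup x∈)
    ... | yes p | _ = p

  ⟦⟧-mono : ∀ {n} {P Q : Pred (Fin n) 0ℓ} (P? : Decidable P) (Q? : Decidable Q) →
            (∀ {x} → P x → Q x) → ⟦ P? ⟧ ⊆ ⟦ Q? ⟧
  ⟦⟧-mono P? Q? P⊆Q = ∈⟦⟧⁺ Q? ∘ P⊆Q ∘ ∈⟦⟧⁻ P?

  indicator : Side → ℕ
  indicator true  = 1
  indicator false = 0

  ∣tabulate∣ : ∀ {n} (p : Fin n → Side) → ∣ tabulate p ∣ ≡ sum (indicator ∘ p)
  ∣tabulate∣ {zero}  p = refl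
  ∣tabulate∣ {suc n} p with p zero
  ... | true  = cong suc (∣tabulate∣ (p ∘ suc))
  ... | false = ∣tabulate∣ (p ∘ suc)

  sum-lower : ∀ {n} a (p : Subset n) (f : Fin n → ℕ) → (∀ {x} → x ∈ p → a ≤ f x) →
              ∣ p ∣ * a ≤ sum f
  sum-lower a []          f h = z≤n
  sum-lower a (true  ∷ p) f h = +-mono-≤ (h here) (sum-lower a p (f ∘ suc) (h ∘ there))
  sum-lower a (false ∷ p) f h = ≤-trans (sum-lower a p (f ∘ suc) (h ∘ there)) (m≤n+m _ (f zero))

  sum-upper : ∀ {n} b (p : Subset n) (f : Fin n → ℕ) → (∀ {x} → x ∈ p → f x ≤ b) →
              (∀ {x} → x ∉ p → f x ≡ 0) → sum f ≤ ∣ p ∣ * b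
  sum-upper b []          f h z = z≤n
  sum-upper b (true  ∷ p) f h z =
    +-mono-≤ (h here) (sum-upper b p (f ∘ suc) (h ∘ there) (λ x∉ → z λ { (there x∈) → x∉ x∈ }))
  sum-upper b (false ∷ p) f h z rewrite z {zero} (λ ()) =
    sum-upper b p (f ∘ suc) (h ∘ there) (λ x∉ → z λ { (there x∈) → x∉ x∈ })

  -- The pairs in `R` are counted by rows from below and by columns from above, and `∑-comm`
  -- exchanges the two sums. Columns outside `q` are empty because `R` only relates to elements of
  -- `q`.
  double-count :
    ∀ {m n} {R : Fin m → Fin n → Set} (R? : Decidable₂ R) (p : Subset m) (q : Subset n) a b →
    (∀ {x y} → R x y → y ∈ q) →
    (∀ {x} → x ∈ p → a ≤ ∣ ⟦ R? x ⟧ ∣) →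
    (∀ {y} → y ∈ q → ∣ ⟦ (λ x → R? x y) ⟧ ∣ ≤ b) →
    ∣ p ∣ * a ≤ ∣ q ∣ * b
  double-count {m} R? p q a b R⊆q rows cols = begin
    ∣ p ∣ * a                                           ≤⟨ sum-lower a p _ rows ⟩
    sum (λ x → ∣ ⟦ R? x ⟧ ∣)
      ≡⟨ sum-cong-≗ (λ x → ∣tabulate∣ (does ∘ R? x)) ⟩
    sum (λ x → sum (λ y → indicator (does (R? x y))))
      ≡⟨ ∑-comm (λ x y → indicator (does (R? x y))) ⟩
    sum (λ y → sum (λ x → indicator (does (R? x y))))
      ≡⟨ sum-cong-≗ (λ y → ∣tabulate∣ (λ x → does (R? x y))) ⟨
    sum (λ y → ∣ ⟦ (λ x → R? x y) ⟧ ∣)                   ≤⟨ sum-upper b q _ cols outside-q ⟩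
    ∣ q ∣ * b                                            ∎
    where
    open ≤-Reasoning
    outside-q : ∀ {y} → y ∉ q → ∣ ⟦ (λ x → R? x y) ⟧ ∣ ≡ 0
    outside-q {y} y∉q = trans
      (cong ∣_∣ (Empty-unique λ (x , x∈) → y∉q (R⊆q (∈⟦⟧⁻ (λ x → R? x y) x∈)))) (∣⊥∣≡0 m)

  inhabited⇒1≤∣∣ : ∀ {n} {p : Subset n} {x} → x ∈ p → 1 ≤ ∣ p ∣
  inhabited⇒1≤∣∣ {p = p} {x} x∈p = subst (_≤ ∣ p ∣) (∣⁅x⁆∣≡1 x)
    (p⊆q⇒∣p∣≤∣q∣ λ y∈ → subst (_∈ p) (sym (x∈⁅y⁆⇒x≡y x y∈)) x∈p)

  ∣p∪q∣≤∣p∣+∣q∣ : ∀ {n} (p q : Subset n) → ∣ p ∪ q ∣ ≤ ∣ p ∣ + ∣ q ∣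
  ∣p∪q∣≤∣p∣+∣q∣ []          []          = z≤n
  ∣p∪q∣≤∣p∣+∣q∣ (true  ∷ p) (s     ∷ q) =
    s≤s (≤-trans (∣p∪q∣≤∣p∣+∣q∣ p q) (+-monoʳ-≤ ∣ p ∣ (∣p∣≤∣x∷p∣ s q)))
  ∣p∪q∣≤∣p∣+∣q∣ (false ∷ p) (true  ∷ q) =
    ≤-trans (s≤s (∣p∪q∣≤∣p∣+∣q∣ p q)) (≤-reflexive (sym (+-suc ∣ p ∣ ∣ q ∣)))
  ∣p∪q∣≤∣p∣+∣q∣ (false ∷ p) (false ∷ q) = ∣p∪q∣≤∣p∣+∣q∣ p q

  shrink : ∀ {n} (p : Subset n) k → k ≤ ∣ p ∣ → ∃[ q ] q ⊆ p × ∣ q ∣ ≡ k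
  shrink {n} p zero _ = ⊥ , ⊥⊆ , ∣⊥∣≡0 n
  shrink (true  ∷ p) (suc k) k≤ with shrink p k (s≤s⁻¹ k≤)
  ... | q , q⊆p , eq = true ∷ q , in⊆in q⊆p , cong suc eq
  shrink (false ∷ p) (suc k) k≤ with shrink p (suc k) k≤
  ... | q , q⊆p , eq = false ∷ q , out⊆ q⊆p , eq

  -- Brings sets that are too small to the common size which `HasCover` demands; a superset still
  -- contains every pair it has to cover.
  enlarge : ∀ {n} (p : Subset n) k → ∣ p ∣ ≤ k → k ≤ n → ∃[ q ] p ⊆ q × ∣ q ∣ ≡ k
  enlarge []          zero    _  _  = [] , (λ ()) , refl
  enlarge (true  ∷ p) (suc k) ≤k k≤ with enlarge p k (s≤s⁻¹ ≤k) (s≤s⁻¹ k≤)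
  ... | q , p⊆q , eq = true ∷ q , in⊆in p⊆q , cong suc eq
  enlarge (false ∷ p) zero    ≤k k≤ with enlarge p zero ≤k z≤n
  ... | q , p⊆q , eq = false ∷ q , s⊆s p⊆q , eq
  enlarge (false ∷ p) (suc k) ≤k k≤ with ∣ p ∣ ≤? k
  ... | yes ≤k′ with enlarge p k ≤k′ (s≤s⁻¹ k≤)
  ...   | q , p⊆q , eq = true ∷ q , out⊆ p⊆q , cong suc eq
  enlarge (false ∷ p) (suc k) ≤k k≤ | no ≰k = false ∷ p , ⊆-refl , ≤-antisym ≤k (≰⇒> ≰k)

  -- Double counting for `R` restricted to `q`: each row over `p` then has at least one entry.
  union-bound :
    ∀ {m n} {R : Fin m → Fin n → Set} (R? : Decidable₂ R) (p : Subset m) (q : Subset n) b →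
    (∀ {x} → x ∈ p → ∃[ y ] y ∈ q × R x y) →
    (∀ {y} → y ∈ q → ∣ ⟦ (λ x → R? x y) ⟧ ∣ ≤ b) →
    ∣ p ∣ ≤ ∣ q ∣ * b
  union-bound R? p q b covered cols = subst (_≤ ∣ q ∣ * b) (*-identityʳ ∣ p ∣)
    (double-count R′? p q 1 b proj₁
      (λ {x} x∈p → case covered x∈p of λ (y , y∈q , r) → inhabited⇒1≤∣∣ (∈⟦⟧⁺ (R′? x) (y∈q , r)))
      (λ {y} y∈q → ≤-trans (p⊆q⇒∣p∣≤∣q∣ (⟦⟧-mono (λ x → R′? x y) (λ x → R? x y) proj₂)) (cols y∈q)))
    where
    R′? = λ x y → (y ∈? q) ×-dec R? x y

  -- The bounds on classes and components below are known only through one of their vertices, so a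
  -- member may be assumed; the empty set satisfies any bound.
  ∣p∣≤-if-inhabited : ∀ {n b} (p : Subset n) → (∀ {x} → x ∈ p → ∣ p ∣ ≤ b) → ∣ p ∣ ≤ b
  ∣p∣≤-if-inhabited {n} p h with nonempty? p
  ... | yes (_ , x∈p) = h x∈p
  ... | no  empty     = subst (_≤ _) (sym (trans (cong ∣_∣ (Empty-unique empty)) (∣⊥∣≡0 n))) z≤n

  -- Spanning trees by merging components

  module _ {A : Set} {R : Rel A 0ℓ} where

    Linked-split : ∀ xs {y ys} → Linked R (xs ++ y ∷ ys) → Linked R (xs ++ [ y ]) × Linked R (y ∷ ys)
    Linked-split []           l       = [-] , l
    Linked-split (x ∷ [])     (r ∷ l) = r ∷ [-] , l
    Linked-split (x ∷ z ∷ xs) (r ∷ l) with Linked-split (z ∷ xs) l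
    ... | l₁ , l₂ = r ∷ l₁ , l₂

    Linked-join : ∀ xs {y ys} → Linked R (xs ++ [ y ]) → Linked R (y ∷ ys) → Linked R (xs ++ y ∷ ys)
    Linked-join []           _       l = l
    Linked-join (x ∷ [])     (r ∷ _) l = r ∷ l
    Linked-join (x ∷ z ∷ xs) (r ∷ k) l = r ∷ Linked-join (z ∷ xs) k l

  -- Rotating a cycle to a chosen start

  module _ {n} {G : Graph n} where

    vertices : Cycle G → List (Fin n)
    vertices C = Cycle.start C ∷ Cycle.others C

    -- Cutting the closed walk at `u` and exchanging its two arcs gives a closed walk from `u`. The
    -- vertex list is only permuted, so length and distinctness carry over.
    rotate : (C : Cycle G) → ∀ {u} → u List.∈ vertices C →
             ∃[ C′ ] Cycle.start {G = G} C′ ≡ u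
    rotate C (here refl) = C , refl
    rotate record { start = s ; long = long ; distinct = distinct ; closed = closed } {u} (there u∈)
      with ∈-∃++ u∈
    ... | as , bs , refl = record
      { start    = u
      ; others   = bs ++ s ∷ as
      ; long     = subst (2 ≤_) (suc-injective (↭-length perm)) long
      ; distinct = Unique-resp-↭ (setoid (Fin n)) (↭⇒↭ₛ perm) distinct
      ; closed   = closed′
      } , refl
      where
      perm : s ∷ as ++ u ∷ bs ↭ u ∷ bs ++ s ∷ as
      perm = ++-comm (s ∷ as) (u ∷ bs)
      closed″ : Linked (Adj G) ((s ∷ as) ++ u ∷ (bs ++ [ s ]))
      closed″ = subst (λ xs → Linked (Adj G) (s ∷ xs)) (++-assoc as (u ∷ bs) [ s ]) closed
      closed′ : Linked (Adj G) (u ∷ (bs ++ s ∷ as) ++ [ u ])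
      closed′ with Linked-split (s ∷ as) closed″
      ... | s→u , u→s = subst (λ xs → Linked (Adj G) (u ∷ xs)) (sym (++-assoc bs (s ∷ as) [ u ]))
        (Linked-join (u ∷ bs) u→s s→u)

  -- Adding an edge between two components creates no cycle

  module _ {n} {H H′ : Graph n} (label : Fin n → Fin n) {u v : Fin n}
           (H⇒≡ : ∀ {a b} → Adj H a b → label a ≡ label b) (u≁v : label u ≢ label v)
           (H′⇒ : ∀ {a b} → Adj H′ a b → Adj H a b ⊎ (a ≡ u × b ≡ v) ⊎ (a ≡ v × b ≡ u)) where

    -- Every edge of `H′` outside `H` has `u` as an endpoint.
    avoid : ∀ {xs} → List.All (u ≢_) xs → Linked (Adj H′) xs → Linked (Adj H) xs
    avoid _ [] = []
    avoid _ [-] = [-]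
    avoid (u≢a ∷ u≢b ∷ u≢) (e ∷ l) with H′⇒ e
    ... | inj₁ e′                 = e′ ∷ avoid (u≢b ∷ u≢) l
    ... | inj₂ (inj₁ (refl , _)) = contradiction refl u≢a
    ... | inj₂ (inj₂ (_ , refl)) = contradiction refl u≢b

    label-along : ∀ a xs {z} → Linked (Adj H) (a ∷ xs ++ [ z ]) → label a ≡ label z
    label-along a []       (e ∷ _) = H⇒≡ e
    label-along a (x ∷ xs) (e ∷ l) = trans (H⇒≡ e) (label-along x xs l)

    -- A cycle through u leaves u by two edges, at most one of which is the new
    -- edge uv, and returns through vertices joined in H.
    acyclic-at-u : ¬ Cycle H → (C : Cycle H′) → Cycle.start C ≢ u
    acyclic-at-u H-acyclic
      record { others = others ; long = long ; distinct = distinct ; closed = closed } refl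
      with initLast others
    ... | (a ∷ ys) ∷ʳ′ z
      with distinct
         | Linked-split (u ∷ a ∷ ys)
             (subst (λ xs → Linked (Adj H′) (u ∷ a ∷ xs)) (++-assoc ys [ z ] [ u ]) closed)
    ... | u≢ ∷ a≢ ∷ _ | ua ∷ a→z , zu ∷ _
      with H′⇒ ua | H′⇒ zu | List.++⁻ʳ (a ∷ ys) u≢ | List.++⁻ʳ ys a≢ | avoid u≢ a→z
    ... | inj₁ ua′ | inj₁ zu′ | _ | _ | a→z′ = H-acyclic record
      { start = u ; others = a ∷ ys ++ [ z ] ; long = long ; distinct = distinct
      ; closed = subst (λ xs → Linked (Adj H) (u ∷ a ∷ xs)) (sym (++-assoc ys [ z ] [ u ]))
                   (ua′ ∷ Linked-join (a ∷ ys) a→z′ (zu′ ∷ [-]))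
      }
    ... | inj₁ ua′ | inj₂ (inj₂ (refl , _)) | _ | _ | a→z′ =
      u≁v (trans (H⇒≡ ua′) (label-along a ys a→z′))
    ... | inj₂ (inj₁ (_ , refl)) | inj₁ zu′ | _ | _ | a→z′ =
      u≁v (sym (trans (label-along a ys a→z′) (H⇒≡ zu′)))
    ... | inj₂ (inj₁ (_ , refl)) | inj₂ (inj₂ (refl , _)) | _ | a≢z ∷ [] | _ = a≢z refl
    ... | _ | inj₂ (inj₁ (refl , _)) | u≢z ∷ [] | _ | _ = u≢z refl
    ... | inj₂ (inj₂ (refl , _)) | _ | _ | _ | _ = u≁v refl
    acyclic-at-u _ record { long = s≤s () } refl | [] ∷ʳ′ z

    -- A cycle through `u` can be rotated to start at `u`, which `acyclic-at-u` excludes; a cycle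
    -- that misses `u` already lies in `H`.
    acyclic-extend : ¬ Cycle H → ¬ Cycle H′
    acyclic-extend H-acyclic C with DecMembership._∈?_ _≟_ u (vertices C)
    ... | yes u∈ with rotate C u∈
    ...   | C′ , eq = acyclic-at-u H-acyclic C′ eq
    acyclic-extend H-acyclic C | no u∉ = H-acyclic record
      { start = C.start ; others = C.others ; long = C.long ; distinct = C.distinct
      ; closed = avoid (List.++⁺ u≢ (List.head u≢ ∷ [])) C.closed
      }
      where
      module C = Cycle C
      u≢ : List.All (u ≢_) (vertices C)
      u≢ = List.¬Any⇒All¬ _ u∉

  -- label v is a representative of the component of v, so roots has one vertex
  -- per component.
  record Forest {n} (G : Graph n) : Set where
    field
      graph      : Graph n
      label      : Fin n → Fin n
      graph⊆     : ∀ {u v} → Adj graph u v → Adj G u v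
      label-idem : ∀ v → label (label v) ≡ label v
      adj⇒≡      : ∀ {u v} → Adj graph u v → label u ≡ label v
      ≡⇒star     : ∀ {u v} → label u ≡ label v → Star (Adj graph) u v
      acyclic    : ¬ Cycle graph

    roots : Subset n
    roots = ⟦ (λ v → label v ≟ v) ⟧

  open Forest

  -- Forests grown by merging along edges

  module _ {n} {G : Graph n} where

    discrete : Forest G
    discrete = record
      { graph      = record { adj = λ _ _ → false ; adj-sym = λ _ _ () ; adj-irrefl = λ _ () }
      ; label      = id
      ; graph⊆     = λ ()
      ; label-idem = λ _ → refl
      ; adj⇒≡      = λ ()
      ; ≡⇒star     = λ { refl → Star.ε }
      ; acyclic    = λ where
          record { others = _ ∷ _ ; closed = () ∷ _ }
          record { others = [] ; long = () }
      }

    module Merge (F : Forest G) {u v} (uv : Adj G u v) (u≁v : label F u ≢ label F v) where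

      -- Applied after `label F`, this gives the component of `v` the representative of `u` and
      -- leaves all other labels alone.
      redirect : Fin n → Fin n
      redirect y with y ≟ label F v
      ... | yes _ = label F u
      ... | no  _ = y

      redirect-yes : ∀ {y} → y ≡ label F v → redirect y ≡ label F u
      redirect-yes {y} eq with y ≟ label F v
      ... | yes _ = refl
      ... | no ≢ = contradiction eq ≢

      redirect-no : ∀ {y} → y ≢ label F v → redirect y ≡ y
      redirect-no {y} ≢ with y ≟ label F v
      ... | yes eq = contradiction eq ≢
      ... | no _ = refl

      label′ : Fin n → Fin n
      label′ w = redirect (label F w)

      Adj⁺ : Fin n → Fin n → Set
      Adj⁺ a b = Adj (graph F) a b ⊎ (a ≡ u × b ≡ v) ⊎ (a ≡ v × b ≡ u)

      adj⁺? : ∀ a b → Dec (Adj⁺ a b)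
      adj⁺? a b = T? (adj (graph F) a b) ⊎-dec ((a ≟ u) ×-dec (b ≟ v)) ⊎-dec ((a ≟ v) ×-dec (b ≟ u))

      graph′ : Graph n
      graph′ = record
        { adj        = λ a b → ⌊ adj⁺? a b ⌋
        ; adj-sym    = λ a b ab → fromWitness {a? = adj⁺? b a} (flip⁺ (toWitness {a? = adj⁺? a b} ab))
        ; adj-irrefl = λ a aa → irrefl⁺ (toWitness {a? = adj⁺? a a} aa)
        }
        where
        flip⁺ : ∀ {a b} → Adj⁺ a b → Adj⁺ b a
        flip⁺ (inj₁ ab)                   = inj₁ (adj-sym (graph F) _ _ ab)
        flip⁺ (inj₂ (inj₁ (refl , refl))) = inj₂ (inj₂ (refl , refl))
        flip⁺ (inj₂ (inj₂ (refl , refl))) = inj₂ (inj₁ (refl , refl))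
        irrefl⁺ : ∀ {a} → ¬ Adj⁺ a a
        irrefl⁺ (inj₁ aa)                   = adj-irrefl (graph F) _ aa
        irrefl⁺ (inj₂ (inj₁ (refl , refl))) = u≁v refl
        irrefl⁺ (inj₂ (inj₂ (refl , refl))) = u≁v refl

      adj⇒adj⁺ : ∀ {a b} → Adj graph′ a b → Adj⁺ a b
      adj⇒adj⁺ {a} {b} = toWitness {a? = adj⁺? a b}

      adj⁺⇒adj : ∀ {a b} → Adj⁺ a b → Adj graph′ a b
      adj⁺⇒adj {a} {b} = fromWitness {a? = adj⁺? a b}

      old : ∀ {a b} → Adj (graph F) a b → Adj graph′ a b
      old = adj⁺⇒adj ∘ inj₁

      new : Adj graph′ u v
      new = adj⁺⇒adj (inj₂ (inj₁ (refl , refl)))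

      new⁻¹ : Adj graph′ v u
      new⁻¹ = adj⁺⇒adj (inj₂ (inj₂ (refl , refl)))

      label′-u : label′ u ≡ label F u
      label′-u = redirect-no u≁v

      label′-v : label′ v ≡ label F u
      label′-v = redirect-yes refl

      star′ : ∀ {a b} → label F a ≡ label F b → Star (Adj graph′) a b
      star′ = Star.map old ∘ ≡⇒star F

      merge : Forest G
      merge = record
        { graph      = graph′
        ; label      = label′
        ; graph⊆     = ⊆G ∘ adj⇒adj⁺
        ; label-idem = idem
        ; adj⇒≡      = adj⇒≡′ ∘ adj⇒adj⁺
        ; ≡⇒star     = ≡⇒star′
        ; acyclic    = acyclic-extend (label F) (adj⇒≡ F) u≁v adj⇒adj⁺ (acyclic F)
        }
        where
        ⊆G : ∀ {a b} → Adj⁺ a b → Adj G a b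
        ⊆G (inj₁ ab)                   = graph⊆ F ab
        ⊆G (inj₂ (inj₁ (refl , refl))) = uv
        ⊆G (inj₂ (inj₂ (refl , refl))) = adj-sym G _ _ uv
        idem : ∀ w → label′ (label′ w) ≡ label′ w
        idem w with label F w ≟ label F v
        ... | yes _  = trans (cong redirect (label-idem F u)) (redirect-no u≁v)
        ... | no w≁v = trans (cong redirect (label-idem F w)) (redirect-no w≁v)
        adj⇒≡′ : ∀ {a b} → Adj⁺ a b → label′ a ≡ label′ b
        adj⇒≡′ (inj₁ ab)                   = cong redirect (adj⇒≡ F ab)
        adj⇒≡′ (inj₂ (inj₁ (refl , refl))) = trans label′-u (sym label′-v)
        adj⇒≡′ (inj₂ (inj₂ (refl , refl))) = trans label′-v (sym label′-u)
        ≡⇒star′ : ∀ {a b} → label′ a ≡ label′ b → Star (Adj graph′) a b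
        ≡⇒star′ {a} {b} eq with label F a ≟ label F v | label F b ≟ label F v
        ... | yes a~v | yes b~v = star′ (trans a~v (sym b~v))
        -- Walk from `a` to `v` in the old component of `v`, cross the new edge to `u`, and continue
        -- in the old component of `u`; the next case is the mirror image.
        ... | yes a~v | no  _   = star′ a~v ◅◅ new⁻¹ ◅ star′ eq
        ... | no  _   | yes b~v = star′ eq ◅◅ new ◅ star′ (sym b~v)
        ... | no  _   | no  _   = star′ eq

      root′⇒root : ∀ {w} → label′ w ≡ w → label F w ≡ w × w ≢ label F v
      root′⇒root {w} eq with label F w ≟ label F v
      -- Here `w` is the label of `u`, whose own label is that of `u` and so cannot be that of `v`.
      ... | yes w~v = contradiction (trans (sym (label-idem F u)) (trans (cong (label F) eq) w~v)) u≁v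
      ... | no  w≁v = eq , λ w≡ → w≁v (trans eq w≡)

      -- The label of `v` stops being a root. The strict decrease makes `saturate` terminate.
      roots′⊂roots : roots merge ⊂ roots F
      roots′⊂roots =
        (λ w∈ → ∈⟦⟧⁺ (λ w → label F w ≟ w) (proj₁ (root′⇒root (∈⟦⟧⁻ (λ w → label′ w ≟ w) w∈)))) ,
        label F v , ∈⟦⟧⁺ (λ w → label F w ≟ w) (label-idem F v) ,
        λ v∈ → proj₂ (root′⇒root (∈⟦⟧⁻ (λ w → label′ w ≟ w) v∈)) refl

      ∣roots∣≤1+∣roots′∣ : ∣ roots F ∣ ≤ suc ∣ roots merge ∣
      ∣roots∣≤1+∣roots′∣ = begin
        ∣ roots F ∣                          ≤⟨ p⊆q⇒∣p∣≤∣q∣ roots⊆ ⟩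
        ∣ ⁅ label F v ⁆ ∪ roots merge ∣      ≤⟨ ∣p∪q∣≤∣p∣+∣q∣ ⁅ label F v ⁆ (roots merge) ⟩
        ∣ ⁅ label F v ⁆ ∣ + ∣ roots merge ∣  ≡⟨ cong (_+ ∣ roots merge ∣) (∣⁅x⁆∣≡1 (label F v)) ⟩
        suc ∣ roots merge ∣                  ∎
        where
        open ≤-Reasoning
        roots⊆ : roots F ⊆ ⁅ label F v ⁆ ∪ roots merge
        roots⊆ {w} w∈ with w ≟ label F v | ∈⟦⟧⁻ (λ w → label F w ≟ w) w∈
        ... | yes refl | _  = x∈p∪q⁺ (inj₁ (x∈⁅x⁆ w))
        ... | no  w≢   | eq = x∈p∪q⁺ (inj₂ (∈⟦⟧⁺ (λ w → label′ w ≟ w)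
                                (trans (cong redirect eq) (redirect-no w≢))))

    open Merge using (merge)

    -- As long as some pair in `R` has different labels, the forest is merged along it. Every merge
    -- loses a root, so fuel above the number of roots suffices; `P` is an invariant of the merges.
    saturate : {R : Fin n → Fin n → Set} → (∀ u v → Dec (R u v)) → (∀ {u v} → R u v → Adj G u v) →
               (P : Forest G → Set) →
               (∀ F {u v} (uv : Adj G u v) (u≁v : label F u ≢ label F v) →
                R u v → P F → P (merge F uv u≁v)) →
               ∀ F → P F → ∃[ F′ ] P F′ × (∀ {u v} → R u v → label F′ u ≡ label F′ v)
    saturate {R} R? R⊆G P step F = go (suc ∣ roots F ∣) F (n<1+n _)
      where
      go : ∀ k F → ∣ roots F ∣ < k → P F → ∃[ F′ ] P F′ × (∀ {u v} → R u v → label F′ u ≡ label F′ v)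
      go (suc k) F <k p with any? (λ u → any? λ v → R? u v ×-dec ¬? (label F u ≟ label F v))
      ... | yes (u , v , r , u≁v) =
        go k (merge F (R⊆G r) u≁v)
           (<-≤-trans (p⊂q⇒∣p∣<∣q∣ (Merge.roots′⊂roots F (R⊆G r) u≁v)) (s≤s⁻¹ <k))
           (step F (R⊆G r) u≁v r p)
      ... | no none = F , p , λ {u} {v} r →
        decidable-stable (label F u ≟ label F v) λ u≁v → none (u , v , r , u≁v)

  -- Counting the edges of one colour

  module _ {A : Set} {P Q R : Pred A 0ℓ} (P? : Decidable P) (Q? : Decidable Q) (R? : Decidable R)
           (P⊆Q : ∀ {x} → P x → Q x) where

    filter-⊑ : ∀ xs → filter R? (filter P? xs) ⊑ filter R? (filter Q? xs)
    filter-⊑ xs = Sublist.filter⁺ R? R? (λ { refl → id })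
      (Sublist.filter⁺ P? Q? (λ { refl → P⊆Q }) (Sublist.⊆-refl {x = xs}))

    -- The first list is a sublist of the second. With equal lengths the two would coincide, but `x`
    -- occurs only in the second.
    filter-strict : ∀ {xs x} → x List.∈ xs → R x → Q x → ¬ P x →
                    length (filter R? (filter P? xs)) < length (filter R? (filter Q? xs))
    filter-strict {xs} x∈ r q ¬p = ≤∧≢⇒< (Sublist.length-mono-≤ (filter-⊑ xs)) λ eq →
      ¬p (proj₂ (∈-filter⁻ P? {xs = xs} (proj₁ (∈-filter⁻ R? {xs = filter P? xs}
        (subst (_ List.∈_) (sym (Pointwise-≡⇒≡ (Sublist.to-≋ eq (filter-⊑ xs))))
          (∈-filter⁺ R? (∈-filter⁺ Q? x∈ q) r))))))

  edge? : ∀ {n} (H : Graph n) → Decidable {A = Fin n × Fin n} (uncurry λ u v → u Fin.< v × Adj H u v)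
  edge? H (u , v) = (u Fin.<? v) ×-dec T? (adj H u v)

  module _ {n r} {G : Graph n} (c : Colouring G r) (i : Fin r) where

    module _ {H H′ : Graph n} (H⊆H′ : ∀ {u v} → Adj H u v → Adj H′ u v) where

      edgesOfColour-mono : length (edgesOfColour c i H) ≤ length (edgesOfColour c i H′)
      edgesOfColour-mono = Sublist.length-mono-≤
        (filter-⊑ (edge? H) (edge? H′) (uncurry (hasColour? c i)) (λ (u<v , uv) → u<v , H⊆H′ uv)
          (cartesianProduct (allFin n) (allFin n)))

      -- The new edge is listed with its smaller endpoint first, so for `v` below `u` the witness is
      -- the reversed pair, which has the same colour by symmetry.
      edgesOfColour-strict : ∀ {u v} → HasColour c i u v → Adj H′ u v → ¬ Adj H u v →
                             length (edgesOfColour c i H) < length (edgesOfColour c i H′)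
      edgesOfColour-strict {u} {v} (e , col) uv ¬uv with <-cmp u v
      ... | tri< u<v _ _ = filter-strict (edge? H) (edge? H′) (uncurry (hasColour? c i))
        (λ (u<v , uv) → u<v , H⊆H′ uv)
        (∈-cartesianProduct⁺ (∈-allFin u) (∈-allFin v)) (e , col) (u<v , uv) (¬uv ∘ proj₂)
      ... | tri≈ _ refl _ = contradiction uv (adj-irrefl H′ u)
      ... | tri> _ _ v<u = filter-strict (edge? H) (edge? H′) (uncurry (hasColour? c i))
        (λ (u<v , uv) → u<v , H⊆H′ uv)
        (∈-cartesianProduct⁺ (∈-allFin v) (∈-allFin u))
        (adj-sym G u v e , trans (sym (colour-sym c u v e (adj-sym G u v e))) col)
        (v<u , adj-sym H′ u v uv) (¬uv ∘ adj-sym H v u ∘ proj₂)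

    -- The vertices fixed by labelling represent the components of colour i, so edges≥
    -- says that tree contains a spanning forest of that colour.
    record SpanningTreeOfColour : Set where
      field
        labelling   : Fin n → Fin n
        colour⇒≡    : ∀ {u v} → HasColour c i u v → labelling u ≡ labelling v
        tree        : Graph n
        spanning    : IsSpanningTree tree G
        edges≥      : n ≤ length (edgesOfColour c i tree) + ∣ ⟦ (λ v → labelling v ≟ v) ⟧ ∣

    -- A potential: the discrete forest has `n` roots, and a merge along an edge of colour `i` gains
    -- an edge of that colour and loses at most one root, so the sum never drops.
    edges+roots : Forest G → ℕ
    edges+roots F = length (edgesOfColour c i (graph F)) + ∣ roots F ∣

    n≤discrete : n ≤ edges+roots discrete
    n≤discrete = begin
      n                             ≡⟨ ∣⊤∣≡n n ⟨
      ∣ ⊤ {n} ∣                     ≤⟨ p⊆q⇒∣p∣≤∣q∣ {p = ⊤} {q = roots (discrete {G = G})}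
                                         (λ _ → ∈⟦⟧⁺ (λ v → v ≟ v) refl) ⟩
      ∣ roots (discrete {G = G}) ∣  ≤⟨ m≤n+m _ _ ⟩
      edges+roots discrete          ∎
      where open ≤-Reasoning

    edges+roots-merge : ∀ F {u v} (uv : Adj G u v) (u≁v : label F u ≢ label F v) → HasColour c i u v →
                        edges+roots F ≤ edges+roots (Merge.merge F uv u≁v)
    edges+roots-merge F uv u≁v col = begin
      #edges F + ∣ roots F ∣
        ≤⟨ +-monoʳ-≤ _ (Merge.∣roots∣≤1+∣roots′∣ F uv u≁v) ⟩
      #edges F + suc ∣ roots F′ ∣
        ≡⟨ +-suc _ _ ⟩
      suc (#edges F) + ∣ roots F′ ∣
        ≤⟨ +-monoˡ-≤ _ (edgesOfColour-strict {H = graph F} {graph F′} (Merge.old F uv u≁v) col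
                          (Merge.new F uv u≁v) (u≁v ∘ adj⇒≡ F)) ⟩
      #edges F′ + ∣ roots F′ ∣ ∎
      where
      open ≤-Reasoning
      F′ = Merge.merge F uv u≁v
      #edges : Forest G → ℕ
      #edges = length ∘ edgesOfColour c i ∘ graph

    -- Merging along colour `i` alone gives `F`; merging on along all edges of `G` extends `F` to
    -- `T`, which is a spanning tree since `G` is connected. The labels recorded are those of `F`,
    -- because those of `T` are all equal.
    spanningTreeOfColour : Connected G → SpanningTreeOfColour
    spanningTreeOfColour connected
      with saturate (hasColour? c i) proj₁ (λ F → n ≤ edges+roots F)
             (λ F uv u≁v col n≤ → ≤-trans n≤ (edges+roots-merge F uv u≁v col)) discrete n≤discrete
    ... | F , n≤ , F-saturated
      with saturate (λ u v → T? (adj G u v)) id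
             (λ F′ → ∀ {u v} → Adj (graph F) u v → Adj (graph F′) u v)
             (λ F′ uv u≁v _ F⊆F′ → Merge.old F′ uv u≁v ∘ F⊆F′) F id
    ...   | T , F⊆T , T-saturated = record
      { labelling = label F
      ; colour⇒≡ = F-saturated
      ; tree = graph T
      ; spanning = (λ _ _ → graph⊆ T) , (λ u v → ≡⇒star T (T-const (connected u v))) , acyclic T
      ; edges≥ = ≤-trans n≤ (+-monoˡ-≤ _ (edgesOfColour-mono {H = graph F} {graph T} F⊆T))
      }
      where
      T-const : ∀ {u v} → Star (Adj G) u v → label T u ≡ label T v
      T-const = Star.fold (λ a b → label T a ≡ label T b) (λ e → trans (T-saturated e)) refl

  -- Covers from vertex types

  -- If every `A i` had fewer than `φ r n` elements, all of them could be enlarged to size `φ r n`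
  -- minus one, and this cover would contradict minimality. The trivial cover shows that this size
  -- is at most `n`.
  φ-least : ∀ {r n} .{{_ : NonZero r}} (A : Fin r → Subset n) →
            (∀ x y → x ≢ y → ∃[ i ] x ∈ A i × y ∈ A i) → ∃[ i ] φ r n ≤ ∣ A i ∣
  φ-least {suc r} {n} A covers with leastCover (suc r) n
  ... | zero  , _ = zero , z≤n
  ... | suc k , _ , minimal with any? (λ i → suc k ≤? ∣ A i ∣)
  ...   | yes large = large
  ...   | no ¬large = contradiction (minimal k cover) 1+n≰n
    where
    k≤n : k ≤ n
    k≤n = <⇒≤ (minimal n (trivialCover (suc r) n))
    enlarged : ∀ i → ∃[ S ] A i ⊆ S × ∣ S ∣ ≡ k
    enlarged i = enlarge (A i) k (s≤s⁻¹ (≰⇒> (¬large ∘ (i ,_)))) k≤n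
    cover : HasCover (suc r) n k
    cover =
      tabulate (proj₁ ∘ enlarged) ,
      All.tabulate⁺ {f = proj₁ ∘ enlarged} (proj₂ ∘ proj₂ ∘ enlarged) ,
      λ x y x≢y → case covers x y x≢y of λ (i , x∈ , y∈) →
        Any.tabulate⁺ {f = proj₁ ∘ enlarged} i
          (proj₁ (proj₂ (enlarged i)) x∈ , proj₁ (proj₂ (enlarged i)) y∈)

  someFin : ∀ r .{{_ : NonZero r}} → Fin r
  someFin (suc _) = zero

  -- Vertex types, rare types and colours shared by two types

  module Types
    {r n} .{{_ : NonZero r}} {G : Graph n} (c : Colouring G r)
    (trees : ∀ i → SpanningTreeOfColour c i) (q b : ℕ)
    (joins : ∀ U W → Empty (U ∩ W) → b ≤ ∣ U ∣ → b ≤ ∣ W ∣ → ∃[ u ] ∃[ w ] u ∈ U × w ∈ W × Adj G u w)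
    where

    -- D is chosen so that b vertices of one class and their neighbours in small
    -- components, at most b r M many, leave b vertices in any class of size D.
    M D : ℕ
    M = 2 * q
    D = b * (2 + r * M)

    open module E i = SpanningTreeOfColour (trees i) public

    fibre : Fin r → Fin n → Subset n
    fibre i v = ⟦ (λ w → labelling i w ≟ labelling i v) ⟧

    Big : Fin r → Fin n → Set
    Big i v = M ≤ ∣ fibre i v ∣

    big? : ∀ i v → Dec (Big i v)
    big? i v = M ≤? ∣ fibre i v ∣

    Big-resp : ∀ i {u v} → labelling i u ≡ labelling i v → Big i u → Big i v
    Big-resp i {u} {v} u~v u-big = ≤-trans u-big (p⊆q⇒∣p∣≤∣q∣
      (⟦⟧-mono (λ w → labelling i w ≟ labelling i u) (λ w → labelling i w ≟ labelling i v)
        (λ w~u → trans w~u u~v)))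

    bit : Fin n → Fin r → Fin 2
    bit v i with big? i v
    ... | yes _ = suc zero
    ... | no  _ = zero

    -- type v is the set of colours i with Big i v, coded as a number below 2 ^ r.
    type : Fin n → Fin (2 ^ r)
    type v = funToFin (bit v)

    Big-type : ∀ {u v} i → type u ≡ type v → Big i u → Big i v
    Big-type {u} {v} i eq u-big
      with big? i u | big? i v
         | trans (sym (finToFun-funToFin (bit u) i))
             (trans (cong (λ t → finToFun t i) eq) (finToFun-funToFin (bit v) i))
    ... | _        | yes v-big | _ = v-big
    ... | no ¬u    | _         | _ = contradiction u-big ¬u
    ... | yes _    | no _      | ()

    class : Fin n → Subset n
    class v = ⟦ (λ w → type w ≟ type v) ⟧

    Rare : Fin n → Set
    Rare v = ∣ class v ∣ < D

    rare? : ∀ v → Dec (Rare v)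
    rare? v = ∣ class v ∣ <? D

    -- There are `2 ^ r` types, and the rare vertices of one type lie in a class of fewer than `D`
    -- vertices.
    ∣rare∣≤ : ∣ ⟦ rare? ⟧ ∣ ≤ 2 ^ r * D
    ∣rare∣≤ = subst (λ k → ∣ ⟦ rare? ⟧ ∣ ≤ k * D) (∣⊤∣≡n (2 ^ r))
      (union-bound R? ⟦ rare? ⟧ ⊤ D (λ {v} v∈ → type v , ∈⊤ , refl , ∈⟦⟧⁻ rare? v∈) λ {t} _ →
        ∣p∣≤-if-inhabited _ λ {v} v∈ → case ∈⟦⟧⁻ (λ v → R? v t) v∈ of λ (v≡t , v-rare) →
          ≤-trans (p⊆q⇒∣p∣≤∣q∣ (⟦⟧-mono (λ w → R? w t) (λ w → type w ≟ type v)
                    (λ (w≡t , _) → trans w≡t (sym v≡t))))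
                  (<⇒≤ v-rare))
      where
      R? : ∀ v t → Dec (type v ≡ t × Rare v)
      R? v t = (type v ≟ t) ×-dec rare? v

    -- Contains all neighbours of `u` along edges in small components, and is easier to count than
    -- those neighbours.
    Near : Fin n → Fin n → Set
    Near u w = ∃[ i ] ¬ Big i u × labelling i w ≡ labelling i u

    near? : ∀ u w → Dec (Near u w)
    near? u w = any? λ i → ¬? (big? i u) ×-dec (labelling i w ≟ labelling i u)

    -- In each of the `r` colours, the component of `u` counts only if it has fewer than `M`
    -- vertices.
    ∣near∣≤ : ∀ u → ∣ ⟦ near? u ⟧ ∣ ≤ r * M
    ∣near∣≤ u = subst (λ k → ∣ ⟦ near? u ⟧ ∣ ≤ k * M) (∣⊤∣≡n r)
      (union-bound R? ⟦ near? u ⟧ ⊤ M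
        (λ w∈ → case ∈⟦⟧⁻ (near? u) w∈ of λ (i , nr) → i , ∈⊤ , nr)
        λ {i} _ →
        ∣p∣≤-if-inhabited _ λ w∈ → case ∈⟦⟧⁻ (λ w → R? w i) w∈ of λ (¬big , _) →
          ≤-trans (p⊆q⇒∣p∣≤∣q∣ (⟦⟧-mono (λ w → R? w i) (λ w → labelling i w ≟ labelling i u) proj₂))
                  (<⇒≤ (≰⇒> ¬big)))
      where
      R? : ∀ w i → Dec (¬ Big i u × labelling i w ≡ labelling i u)
      R? w i = ¬? (big? i u) ×-dec (labelling i w ≟ labelling i u)

    edge⇒big⊎near : ∀ {u w} → Adj G u w → (∃[ i ] Big i u × Big i w) ⊎ Near u w
    edge⇒big⊎near {u} {w} e with big? (colour c u w e) u
    ... | yes u-big = inj₁ (_ , u-big , Big-resp _ (colour⇒≡ _ (e , refl)) u-big)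
    ... | no ¬u-big = inj₂ (_ , ¬u-big , sym (colour⇒≡ _ (e , refl)))

    -- Take `b` vertices `U` from the class of `x`, and let `W` be the class of `y` without `U` and
    -- everything near `U`. An edge between `U` and `W` is not near, so its component is big, and
    -- its colour belongs to both types. Removing `U` keeps the sets disjoint even when the classes
    -- coincide; the case of equal `x` and `y` shows that a type which is not rare is nonempty.
    common-big : ∀ {x y} → ¬ Rare x → ¬ Rare y → ∃[ i ] Big i x × Big i y
    common-big {x} {y} ¬x-rare ¬y-rare
      with shrink (class x) b (≤-trans (m≤m*n b (2 + r * M)) (≮⇒≥ ¬x-rare))
    ... | U , U⊆ , ∣U∣≡b =
      case joins U W disjoint (≤-reflexive (sym ∣U∣≡b)) b≤∣W∣ of λ (u , w , u∈U , w∈W , e) →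
      case edge⇒big⊎near e of λ where
        (inj₁ (i , u-big , w-big)) →
          i , Big-type i (∈⟦⟧⁻ (λ v → type v ≟ type x) (U⊆ u∈U)) u-big
            , Big-type i (∈⟦⟧⁻ (λ v → type v ≟ type y) (p─q⊆p (class y) (U ∪ N) w∈W)) w-big
        (inj₂ u-near-w) →
          contradiction (x∈p∪q⁺ (inj₂ (∈⟦⟧⁺ N? (u , u∈U , u-near-w)))) (x∈p─q⇒x∉q w∈W)
      where
      N? : ∀ w → Dec (∃[ u ] u ∈ U × Near u w)
      N? w = any? λ u → (u ∈? U) ×-dec near? u w
      N W : Subset n
      N = ⟦ N? ⟧
      W = class y ─ (U ∪ N)
      x∈p─q⇒x∉q : ∀ {n} {p q : Subset n} {x} → x ∈ p ─ q → x ∉ q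
      x∈p─q⇒x∉q {p = _ Vec.∷ p} {_ Vec.∷ q} (Vec.there x∈) (Vec.there x∈q) = x∈p─q⇒x∉q x∈ x∈q
      disjoint : Empty (U ∩ W)
      disjoint (x , x∈) with x∈p∩q⁻ U W x∈
      ... | x∈U , x∈W = x∈p─q⇒x∉q x∈W (x∈p∪q⁺ (inj₁ x∈U))
      ∣N∣≤ : ∣ N ∣ ≤ b * (r * M)
      ∣N∣≤ = subst (λ k → ∣ N ∣ ≤ k * (r * M)) ∣U∣≡b
        (union-bound (λ w u → near? u w) N U (r * M) (∈⟦⟧⁻ N?) (λ {u} _ → ∣near∣≤ u))
      class⊆ : class y ⊆ W ∪ (U ∪ N)
      class⊆ {v} v∈ with v ∈? U ∪ N
      ... | yes v∈′ = x∈p∪q⁺ (inj₂ v∈′)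
      ... | no  v∉  = x∈p∪q⁺ (inj₁ (x∈p∧x∉q⇒x∈p─q v∈ v∉))
      b≤∣W∣ : b ≤ ∣ W ∣
      b≤∣W∣ = +-cancelʳ-≤ (b + b * (r * M)) b ∣ W ∣ (begin
        b + (b + b * (r * M))       ≡⟨ trans (*-suc b (suc (r * M))) (cong (b +_) (*-suc b (r * M))) ⟨
        b * (2 + r * M)             ≤⟨ ≮⇒≥ ¬y-rare ⟩
        ∣ class y ∣                 ≤⟨ p⊆q⇒∣p∣≤∣q∣ class⊆ ⟩
        ∣ W ∪ (U ∪ N) ∣             ≤⟨ ∣p∪q∣≤∣p∣+∣q∣ W (U ∪ N) ⟩
        ∣ W ∣ + ∣ U ∪ N ∣           ≤⟨ +-monoʳ-≤ ∣ W ∣ (∣p∪q∣≤∣p∣+∣q∣ U N) ⟩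
        ∣ W ∣ + (∣ U ∣ + ∣ N ∣)     ≤⟨ +-monoʳ-≤ ∣ W ∣ (+-mono-≤ (≤-reflexive ∣U∣≡b) ∣N∣≤) ⟩
        ∣ W ∣ + (b + b * (r * M))   ∎)
        where open ≤-Reasoning

    -- Large components and the edges of a colour

    root? : ∀ i v → Dec (labelling i v ≡ v)
    root? i v = labelling i v ≟ v

    bigRoot? : ∀ i v → Dec (labelling i v ≡ v × Big i v)
    bigRoot? i v = root? i v ×-dec big? i v

    -- Distinct roots have disjoint label classes, and those counted here have at least `M` vertices
    -- each.
    ∣bigRoots∣≤ : ∀ i → ∣ ⟦ bigRoot? i ⟧ ∣ * M ≤ n
    ∣bigRoots∣≤ i = subst (∣ ⟦ bigRoot? i ⟧ ∣ * M ≤_) (trans (*-identityʳ _) (∣⊤∣≡n n))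
      (double-count (λ v w → labelling i w ≟ v) ⟦ bigRoot? i ⟧ ⊤ M 1 (λ _ → ∈⊤)
        (λ {v} v∈ → case ∈⟦⟧⁻ (bigRoot? i) v∈ of λ (v-root , v-big) → ≤-trans v-big
          (p⊆q⇒∣p∣≤∣q∣ (⟦⟧-mono (λ w → labelling i w ≟ labelling i v) (λ w → labelling i w ≟ v)
            (λ w~v → trans w~v v-root))))
        (λ {w} _ → subst (∣ ⟦ (λ v → labelling i w ≟ v) ⟧ ∣ ≤_) (∣⁅x⁆∣≡1 (labelling i w))
          (p⊆q⇒∣p∣≤∣q∣ {q = ⁅ labelling i w ⁆} λ v∈ →
            subst (_∈ ⁅ labelling i w ⁆) (∈⟦⟧⁻ (λ v → labelling i w ≟ v) v∈) (x∈⁅x⁆ (labelling i w)))))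

    #edges : Fin r → ℕ
    #edges i = length (edgesOfColour c i (tree i))

    -- A vertex in a big component is a big root or no root at all, and by `edges≥` the vertices
    -- that are not roots number at most `#edges i`.
    ∣big∣≤ : ∀ i → ∣ ⟦ big? i ⟧ ∣ ≤ #edges i + ∣ ⟦ bigRoot? i ⟧ ∣
    ∣big∣≤ i = begin
      ∣ ⟦ big? i ⟧ ∣
        ≤⟨ p⊆q⇒∣p∣≤∣q∣ big⊆ ⟩
      ∣ ∁ ⟦ root? i ⟧ ∪ ⟦ bigRoot? i ⟧ ∣
        ≤⟨ ∣p∪q∣≤∣p∣+∣q∣ (∁ ⟦ root? i ⟧) ⟦ bigRoot? i ⟧ ⟩
      ∣ ∁ ⟦ root? i ⟧ ∣ + ∣ ⟦ bigRoot? i ⟧ ∣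
        ≡⟨ cong (_+ ∣ ⟦ bigRoot? i ⟧ ∣) (∣∁p∣≡n∸∣p∣ ⟦ root? i ⟧) ⟩
      n ∸ ∣ ⟦ root? i ⟧ ∣ + ∣ ⟦ bigRoot? i ⟧ ∣
        ≤⟨ +-monoˡ-≤ _ n∸∣roots∣≤ ⟩
      #edges i + ∣ ⟦ bigRoot? i ⟧ ∣ ∎
      where
      open ≤-Reasoning
      n∸∣roots∣≤ : n ∸ ∣ ⟦ root? i ⟧ ∣ ≤ #edges i
      n∸∣roots∣≤ = m≤n+o⇒m∸n≤o n ∣ ⟦ root? i ⟧ ∣
        (subst (n ≤_) (+-comm (#edges i) ∣ ⟦ root? i ⟧ ∣) (edges≥ i))
      big⊆ : ⟦ big? i ⟧ ⊆ ∁ ⟦ root? i ⟧ ∪ ⟦ bigRoot? i ⟧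
      big⊆ {v} v∈ with root? i v
      ... | yes v-root = x∈p∪q⁺ (inj₂ (∈⟦⟧⁺ (bigRoot? i) (v-root , ∈⟦⟧⁻ (big? i) v∈)))
      ... | no ¬v-root = x∈p∪q⁺ (inj₁ (x∉p⇒x∈∁p (¬v-root ∘ ∈⟦⟧⁻ (root? i))))

    A : Fin r → Subset n
    A i = ⟦ rare? ⟧ ∪ ⟦ big? i ⟧

    rare⊆A : ∀ {i v} → Rare v → v ∈ A i
    rare⊆A v-rare = x∈p∪q⁺ (inj₁ (∈⟦⟧⁺ rare? v-rare))

    big⊆A : ∀ {i v} → Big i v → v ∈ A i
    big⊆A {i} v-big = x∈p∪q⁺ (inj₂ (∈⟦⟧⁺ (big? i) v-big))

    A-covers : ∀ x y → ∃[ i ] x ∈ A i × y ∈ A i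
    A-covers x y with rare? x | rare? y
    -- Rare vertices lie in every `A i`, so any index serves.
    ... | yes x-rare | yes y-rare = someFin r , rare⊆A x-rare , rare⊆A y-rare
    -- Only a colour in the type of `y` is needed, and `common-big` at `y` twice supplies one.
    ... | yes x-rare | no ¬y-rare =
      case common-big ¬y-rare ¬y-rare of λ (i , y-big , _) → i , rare⊆A x-rare , big⊆A y-big
    ... | no ¬x-rare | yes y-rare =
      case common-big ¬x-rare ¬x-rare of λ (i , x-big , _) → i , big⊆A x-big , rare⊆A y-rare
    ... | no ¬x-rare | no ¬y-rare =
      case common-big ¬x-rare ¬y-rare of λ (i , x-big , y-big) → i , big⊆A x-big , big⊆A y-big

    -- After doubling, the rare vertices cost at most `n` by hypothesis, and the big roots cost
    -- `2 * q * ρ`, which is `ρ * M` and hence at most `n`. Each of the two losses is thus at most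
    -- n/(2q).
    many-edges : 2 * (q * (2 ^ r * D)) ≤ n → ∃[ i ] q * φ r n ≤ n + q * #edges i
    many-edges D-small with φ-least A (λ x y _ → A-covers x y)
    ... | i , φ≤ = i , *-cancelˡ-≤ 2 (begin
      2 * (q * φ r n)
        ≤⟨ *-monoʳ-≤ 2 (*-monoʳ-≤ q (≤-trans φ≤
             (≤-trans (∣p∪q∣≤∣p∣+∣q∣ ⟦ rare? ⟧ ⟦ big? i ⟧) (+-mono-≤ ∣rare∣≤ (∣big∣≤ i))))) ⟩
      2 * (q * (2 ^ r * D + (#edges i + ρ)))
        ≡⟨ rearrange q (2 ^ r * D) (#edges i) ρ ⟩
      2 * (q * (2 ^ r * D)) + (2 * (q * #edges i) + ρ * M)
        ≤⟨ +-mono-≤ D-small (+-monoʳ-≤ (2 * (q * #edges i)) (∣bigRoots∣≤ i)) ⟩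
      n + (2 * (q * #edges i) + n)
        ≡⟨ regroup n (q * #edges i) ⟩
      2 * (n + q * #edges i) ∎)
      where
      open ≤-Reasoning
      ρ : ℕ
      ρ = ∣ ⟦ bigRoot? i ⟧ ∣
      rearrange : ∀ q a e ρ → 2 * (q * (a + (e + ρ))) ≡ 2 * (q * a) + (2 * (q * e) + ρ * (2 * q))
      rearrange = solve 4 (λ q a e ρ →
        con 2 :* (q :* (a :+ (e :+ ρ)))
          := con 2 :* (q :* a) :+ (con 2 :* (q :* e) :+ ρ :* (con 2 :* q))) refl
      regroup : ∀ n e → n + (2 * e + n) ≡ 2 * (n + e)
      regroup = solve 2 (λ n e → n :+ (con 2 :* e :+ n) := con 2 :* (n :+ e)) refl

open import Data.Integer.Base as ℤ using (+_; +[1+_]; +≤+)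
import Data.Integer.Properties as ℤ
open import Data.Rational.Base
  using (ℚ; mkℚ; Positive; 0ℚ; _<_; _≤_; *<*; _*_; _-_; _+_; -_; _/_; 1/_; toℚᵘ)
import Data.Rational.Base as ℚ
import Data.Rational.Properties as ℚ
import Data.Rational.Solver as ℚ
open import Data.Rational.Unnormalised.Base as ℚᵘ using (mkℚᵘ; *≤*; *≡*)
import Data.Rational.Unnormalised.Properties as ℚᵘ

-- Rational bounds

toℚᵘ-/ : ∀ a b → toℚᵘ (+ a / suc b) ℚᵘ.≃ mkℚᵘ (+ a) b
toℚᵘ-/ a b = ℚ.toℚᵘ-fromℚᵘ (mkℚᵘ (+ a) b)

/-≤⁺ : ∀ a b c d .{{_ : NonZero b}} .{{_ : NonZero d}} → a ℕ.* d ℕ.≤ c ℕ.* b → + a / b ≤ + c / d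
/-≤⁺ a (suc b) c (suc d) ad≤cb = ℚ.toℚᵘ-cancel-≤
  (ℚᵘ.≤-respˡ-≃ (ℚᵘ.≃-sym (toℚᵘ-/ a b)) (ℚᵘ.≤-respʳ-≃ (ℚᵘ.≃-sym (toℚᵘ-/ c d))
    (*≤* (subst₂ ℤ._≤_ (ℤ.pos-* a (suc d)) (ℤ.pos-* c (suc b)) (+≤+ ad≤cb)))))

/-≤⁻ : ∀ a b c d .{{_ : NonZero b}} .{{_ : NonZero d}} → + a / b ≤ + c / d → a ℕ.* d ℕ.≤ c ℕ.* b
/-≤⁻ a (suc b) c (suc d) le
  with ℚᵘ.≤-respˡ-≃ (toℚᵘ-/ a b) (ℚᵘ.≤-respʳ-≃ (toℚᵘ-/ c d) (ℚ.toℚᵘ-mono-≤ le))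
... | *≤* ad≤cb = ℤ.drop‿+≤+ (subst₂ ℤ._≤_ (sym (ℤ.pos-* a (suc d))) (sym (ℤ.pos-* c (suc b))) ad≤cb)

/-+ : ∀ a b c d .{{_ : NonZero b}} .{{_ : NonZero d}} →
      let instance _ = ℕ.m*n≢0 b d in + a / b + + c / d ≡ + (a ℕ.* d ℕ.+ c ℕ.* b) / (b ℕ.* d)
/-+ a (suc b) c (suc d) = ℚ.toℚᵘ-injective (ℚᵘ.≃-trans (ℚ.toℚᵘ-homo-+ (+ a / suc b) (+ c / suc d))
  (ℚᵘ.≃-trans (ℚᵘ.+-cong (toℚᵘ-/ a b) (toℚᵘ-/ c d))
  (ℚᵘ.≃-trans (*≡* (cong (ℤ._* + (suc b ℕ.* suc d)) (sym num)))
    (ℚᵘ.≃-sym (toℚᵘ-/ (a ℕ.* suc d ℕ.+ c ℕ.* suc b) (d ℕ.+ b ℕ.* suc d))))))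
  where
  num : + (a ℕ.* suc d ℕ.+ c ℕ.* suc b) ≡ + a ℤ.* + suc d ℤ.+ + c ℤ.* + suc b
  num = cong₂ ℤ._+_ (ℤ.pos-* a (suc d)) (ℤ.pos-* c (suc b))

/-* : ∀ a b c d .{{_ : NonZero b}} .{{_ : NonZero d}} →
      let instance _ = ℕ.m*n≢0 b d in (+ a / b) * (+ c / d) ≡ + (a ℕ.* c) / (b ℕ.* d)
/-* a (suc b) c (suc d) = ℚ.toℚᵘ-injective (ℚᵘ.≃-trans (ℚ.toℚᵘ-homo-* (+ a / suc b) (+ c / suc d))
  (ℚᵘ.≃-trans (ℚᵘ.*-cong (toℚᵘ-/ a b) (toℚᵘ-/ c d))
  (ℚᵘ.≃-trans (*≡* (cong (ℤ._* + (suc b ℕ.* suc d)) (sym (ℤ.pos-* a c))))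
    (ℚᵘ.≃-sym (toℚᵘ-/ (a ℕ.* c) (d ℕ.+ b ℕ.* suc d))))))

module _ (B : ℕ) .{{_ : NonZero B}} where

  1/B>0 : Positive (+ 1 / B)
  1/B>0 = ℚ.normalize-pos 1 B

  1/B*n≡ : ∀ n → let instance _ = ℕ.m*n≢0 B 1 in (+ 1 / B) * ℕ→ℚ n ≡ + (1 ℕ.* n) / (B ℕ.* 1)
  1/B*n≡ n = /-* 1 B n 1

  -- Multiplying by 1/B turns the left side into 1, so the reciprocal need not be evaluated.
  1/1/B≤⇒B≤ : ∀ {n} → (1/ (+ 1 / B)) {{ℚ.pos⇒nonZero (+ 1 / B) {{1/B>0}}}} ≤ ℕ→ℚ n → B ℕ.≤ n
  1/1/B≤⇒B≤ {n} le = subst₂ ℕ._≤_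
    (trans (ℕ.*-identityˡ _) (ℕ.*-identityʳ B)) (trans (ℕ.*-identityʳ _) (ℕ.*-identityˡ n))
    (/-≤⁻ 1 1 (1 ℕ.* n) (B ℕ.* 1) {{_}} {{ℕ.m*n≢0 B 1}}
      (subst₂ _≤_ (ℚ.*-inverseʳ (+ 1 / B) {{ℚ.pos⇒nonZero (+ 1 / B) {{1/B>0}}}}) (1/B*n≡ n)
        (ℚ.*-monoˡ-≤-nonNeg (+ 1 / B) {{ℚ.pos⇒nonNeg (+ 1 / B) {{1/B>0}}}} le)))

  n≤B*m⇒ : ∀ {n m} → n ℕ.≤ B ℕ.* m → (+ 1 / B) * ℕ→ℚ n ≤ ℕ→ℚ m
  n≤B*m⇒ {n} {m} le = subst (_≤ ℕ→ℚ m) (sym (1/B*n≡ n))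
    (/-≤⁺ (1 ℕ.* n) (B ℕ.* 1) m 1 {{ℕ.m*n≢0 B 1}} (subst₂ ℕ._≤_
      (sym (trans (ℕ.*-identityʳ _) (ℕ.*-identityˡ n)))
      (trans (ℕ.*-comm B m) (cong (m ℕ.*_) (sym (ℕ.*-identityʳ B)))) le))

-- The two summands add up to one over the denominator of `ε`, and the numerator of `ε` is at least
-- 1.
half : ∀ ε → 0ℚ < ε → let instance _ = ℕ.m*n≢0 2 (ℚ.↧ₙ ε) in
       + 1 / (2 ℕ.* ℚ.↧ₙ ε) + + 1 / (2 ℕ.* ℚ.↧ₙ ε) ≤ ε
half (mkℚ (+ zero) d-1 _) (*<* (ℤ.+<+ ()))
half ε@(mkℚ +[1+ p ] d-1 _) _ = subst₂ _≤_ (sym (/-+ 1 e 1 e)) (ℚ.fromℚᵘ-toℚᵘ ε)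
  (/-≤⁺ (1 ℕ.* e ℕ.+ 1 ℕ.* e) (e ℕ.* e) (suc p) d (begin
    (1 ℕ.* e ℕ.+ 1 ℕ.* e) ℕ.* d  ≡⟨ solve 1 (λ d → (con 1 :* (con 2 :* d) :+ con 1 :* (con 2 :* d)) :* d
                                             := con 1 :* (con 2 :* d :* (con 2 :* d))) refl d ⟩
    1 ℕ.* (e ℕ.* e)              ≤⟨ ℕ.*-monoˡ-≤ (e ℕ.* e) (s≤s (z≤n {p})) ⟩
    suc p ℕ.* (e ℕ.* e)          ∎))
  where
  open ℕ.≤-Reasoning
  open +-*-Solver
  d e : ℕ
  d = suc d-1
  e = 2 ℕ.* d

-- From the integer bound on edges to the rational one

module _ (n F e q : ℕ) .{{n≢0 : NonZero n}} .{{_ : NonZero q}} (φr ε δ : ℚ) where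

  -- Dividing the last hypothesis by qn gives F/n at most 1/q + e/n. Replacing `φr` by F/n costs at
  -- most `δ`, the term 1/q at most another `δ`, and the two together fit into `ε`.
  rational-bound : δ + δ ≤ ε → + 1 / q ≤ δ → ℚ.∣ + F / n - φr ∣ < δ → q ℕ.* F ℕ.≤ n ℕ.+ q ℕ.* e →
                   (φr - ε) * ℕ→ℚ n ≤ ℕ→ℚ e
  rational-bound 2δ≤ε 1/q≤δ close qF≤ = begin
    (φr - ε) * ℕ→ℚ n
      ≤⟨ ℚ.*-monoʳ-≤-nonNeg (ℕ→ℚ n) {{ℚ.normalize-nonNeg n 1}} φr-ε≤ ⟩
    (+ e / n) * ℕ→ℚ n
      ≡⟨ /-* e n n 1 ⟩
    (+ (e ℕ.* n) / (n ℕ.* 1)) {{n*1≢0}}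
      ≤⟨ /-≤⁺ (e ℕ.* n) (n ℕ.* 1) e 1 {{n*1≢0}} (ℕ.≤-reflexive (ℕ.*-assoc e n 1)) ⟩
    ℕ→ℚ e ∎
    where
    open ℚ.≤-Reasoning
    n*1≢0 : NonZero (n ℕ.* 1)
    n*1≢0 = ℕ.m*n≢0 n 1
    F/n≤ : + F / n ≤ + 1 / q + + e / n
    F/n≤ = subst (+ F / n ≤_) (sym (/-+ 1 q e n))
      (/-≤⁺ F n (1 ℕ.* n ℕ.+ e ℕ.* q) (q ℕ.* n) {{n≢0}} {{ℕ.m*n≢0 q n}} (subst₂ ℕ._≤_
        (solve 3 (λ q F n → q :* F :* n := F :* (q :* n)) refl q F n)
        (cong (ℕ._* n) (solve 3 (λ n q e → n :+ q :* e := con 1 :* n :+ e :* q) refl n q e))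
        (ℕ.*-monoˡ-≤ n qF≤)))
      where open +-*-Solver
    φr-F/n≤δ : φr - + F / n ≤ δ
    φr-F/n≤δ = begin
      φr - + F / n            ≤⟨ p≤∣p∣ (φr - + F / n) ⟩
      ℚ.∣ φr - + F / n ∣      ≡⟨ ℚ.∣-p∣≡∣p∣ (φr - + F / n) ⟨
      ℚ.∣ - (φr - + F / n) ∣  ≡⟨ cong ℚ.∣_∣ (neg-sub φr (+ F / n)) ⟩
      ℚ.∣ + F / n - φr ∣      ≤⟨ ℚ.<⇒≤ close ⟩
      δ                       ∎
      where
      open ℚ.+-*-Solver
      p≤∣p∣ : ∀ p → p ≤ ℚ.∣ p ∣
      p≤∣p∣ p@(mkℚ (+ _)      _ _) = ℚ.≤-refl {p}
      p≤∣p∣ (mkℚ (ℤ.-[1+ _ ]) _ _) = ℚ.*≤* ℤ.-≤+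
      neg-sub : ∀ p q → - (p - q) ≡ q - p
      neg-sub = solve 2 (λ p q → :- (p :- q) := q :- p) refl
    φr-ε≤ : φr - ε ≤ + e / n
    φr-ε≤ = begin
      φr - ε
        ≡⟨ split φr ε (+ F / n) ⟩
      (φr - + F / n) + (+ F / n) - ε
        ≤⟨ ℚ.+-monoˡ-≤ (- ε) (ℚ.+-mono-≤ φr-F/n≤δ (ℚ.≤-trans F/n≤ (ℚ.+-monoˡ-≤ (+ e / n) 1/q≤δ))) ⟩
      δ + (δ + + e / n) - ε
        ≡⟨ regroup δ (+ e / n) ε ⟩
      (δ + δ) + (+ e / n - ε)
        ≤⟨ ℚ.+-monoˡ-≤ (+ e / n - ε) 2δ≤ε ⟩
      ε + (+ e / n - ε)
        ≡⟨ cancel ε (+ e / n) ⟩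
      + e / n ∎
      where
      open ℚ.+-*-Solver
      split : ∀ a b c → a - b ≡ (a - c) + c - b
      split = solve 3 (λ a b c → a :- b := (a :- c) :+ c :- b) refl
      regroup : ∀ d x e → d + (d + x) - e ≡ (d + d) + (x - e)
      regroup = solve 3 (λ d x e → d :+ (d :+ x) :- e := (d :+ d) :+ (x :- e)) refl
      cancel : ∀ e x → e + (x - e) ≡ x
      cancel = solve 2 (λ e x → e :+ (x :- e) := x) refl

theorem1p10 : ∀ (r : ℕ) .{{_ : NonTrivial r}} (φr : ℚ) → IsLimitφ r {{nonTrivial⇒nonZero r}} φr →
    ∀ (ε : ℚ) → 0ℚ < ε →
    ∃[ β ] Σ[ β>0 ∈ Positive β ]
    (∀ (n : ℕ) (G : Graph n) → Connected G → IsβGraph β {{β>0}} G →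
    ∀ (c : Colouring G r) →
    ∃[ H ] IsSpanningTree H G ×
    (∃[ i ] (φr - ε) * ℕ→ℚ n ≤ ℕ→ℚ (length (edgesOfColour c i H))))
theorem1p10 r φr φ→φr ε ε>0 = + 1 / B , β>0 , λ n G connected βG c →
  let
    B≤n = 1/1/B≤⇒B≤ B (IsβGraph.order βG)
    -- Rounding n/B up in this way ensures that any set of at least `b` vertices meets the size
    -- condition for `β` equal to 1/B.
    b   = suc (n ℕ./ B)
    open Types c (λ i → spanningTreeOfColour c i connected) q b (λ U W disj b≤∣U∣ b≤∣W∣ →
           IsβGraph.joins βG U W disj (n≤B*m⇒ B (n≤B*b n b≤∣U∣)) (n≤B*m⇒ B (n≤B*b n b≤∣W∣)))
    i , φ≤ = many-edges (2qKD≤n n B≤n)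
    instance n≢0 = ℕ.>-nonZero (ℕ.<-≤-trans (ℕ.>-nonZero⁻¹ B) B≤n)
  in
  tree i , spanning i , i ,
  rational-bound n (φ r n) (#edges i) q φr ε δ (half ε ε>0)
    (/-≤⁺ 1 q 1 d {{q≢0}} {{d≢0}}
      (subst₂ ℕ._≤_ (sym (ℕ.*-identityˡ d)) (sym (ℕ.*-identityˡ q)) (ℕ.m≤m*n d (suc N))))
    (proj₂ limit n (ℕ.≤-trans N≤B B≤n)) φ≤
  where
  open +-*-Solver
  instance
    r≢0 : NonZero r
    r≢0 = nonTrivial⇒nonZero r
  d : ℕ
  d = 2 ℕ.* ℚ.↧ₙ ε
  instance
    d≢0 : NonZero d
    d≢0 = ℕ.m*n≢0 2 (ℚ.↧ₙ ε)
  δ : ℚ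
  δ = + 1 / d
  limit : ∃[ N ] ∀ n .{{_ : NonZero n}} → N ℕ.≤ n → ℚ.∣ + φ r n / n - φr ∣ < δ
  limit = φ→φr δ (ℚ.positive⁻¹ δ {{1/B>0 d}})
  -- q makes 1/q at most δ and B at least N; then B is such that n ≥ B bounds the
  -- number of vertices of rare type by n/(2q).
  N q w X B : ℕ
  N = proj₁ limit
  q = d ℕ.* suc N
  w = 2 ℕ.+ r ℕ.* (2 ℕ.* q)
  X = q ℕ.* (2 ℕ.^ r ℕ.* w)
  B = 4 ℕ.* X
  instance
    q≢0 : NonZero q
    q≢0 = ℕ.m*n≢0 d (suc N)
    2^r≢0 : NonZero (2 ℕ.^ r)
    2^r≢0 = ℕ.m^n≢0 2 r
    2^r*w≢0 : NonZero (2 ℕ.^ r ℕ.* w)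
    2^r*w≢0 = ℕ.m*n≢0 (2 ℕ.^ r) w
    X≢0 : NonZero X
    X≢0 = ℕ.m*n≢0 q (2 ℕ.^ r ℕ.* w)
    B≢0 : NonZero B
    B≢0 = ℕ.m*n≢0 4 X
    β>0 : Positive (+ 1 / B)
    β>0 = 1/B>0 B
  N≤B : N ℕ.≤ B
  N≤B = begin
    N        ≤⟨ ℕ.n≤1+n N ⟩
    suc N    ≤⟨ ℕ.m≤n*m (suc N) d ⟩
    q        ≤⟨ ℕ.m≤m*n q (2 ℕ.^ r ℕ.* w) ⟩
    X        ≤⟨ ℕ.m≤n*m X 4 ⟩
    B        ∎
    where open ℕ.≤-Reasoning
  n≤B*b : ∀ n {k} → suc (n ℕ./ B) ℕ.≤ k → n ℕ.≤ B ℕ.* k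
  n≤B*b n {k} b≤k = begin
    n                              ≡⟨ m≡m%n+[m/n]*n n B ⟩
    n ℕ.% B ℕ.+ n ℕ./ B ℕ.* B      ≤⟨ ℕ.+-monoˡ-≤ (n ℕ./ B ℕ.* B) (ℕ.<⇒≤ (m%n<n n B)) ⟩
    suc (n ℕ./ B) ℕ.* B            ≤⟨ ℕ.*-monoˡ-≤ B b≤k ⟩
    k ℕ.* B                        ≡⟨ ℕ.*-comm k B ⟩
    B ℕ.* k                        ∎
    where open ℕ.≤-Reasoning
  -- Since `B` is `4 * X`, twice the left side is `B` times the floor of n/B plus one. This is at
  -- most `B + n`, hence at most `2 * n`.
  2qKD≤n : ∀ n → B ℕ.≤ n → 2 ℕ.* (q ℕ.* (2 ℕ.^ r ℕ.* (suc (n ℕ./ B) ℕ.* w))) ℕ.≤ n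
  2qKD≤n n B≤n = ℕ.*-cancelˡ-≤ 2 (begin
    2 ℕ.* (2 ℕ.* (q ℕ.* (2 ℕ.^ r ℕ.* (suc (n ℕ./ B) ℕ.* w))))
      ≡⟨ solve 4 (λ q K b w → con 2 :* (con 2 :* (q :* (K :* (b :* w))))
                       := b :* (con 4 :* (q :* (K :* w))))
           refl q (2 ℕ.^ r) (suc (n ℕ./ B)) w ⟩
    B ℕ.+ n ℕ./ B ℕ.* B   ≤⟨ ℕ.+-mono-≤ B≤n (m/n*n≤m n B) ⟩
    n ℕ.+ n               ≡⟨ cong (n ℕ.+_) (ℕ.+-identityʳ n) ⟨
    2 ℕ.* n               ∎)
    where open ℕ.≤-Reasoning
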